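{- Suppose the $(\min,-)$ matrix product of two $m\times m$ real matrices can be computed in $T(m)$ time for every $m$. Then the $(\min,-)$ convolution of two vectors of length $n$ can be computed in $O\big((n+T(\sqrt n))\sqrt n\big)$ time.
   Context: The $(\min,-)$ matrix product of an $a\times b$ matrix $A$ and a $b\times c$ matrix $B$ is the $a\times c$ matrix $P$ with $P_{i,j}=\min_{m}(A_{i,m}-B_{m,j})$. For vectors $\vec x=\langle x_0,\dots,x_{n-1}\rangle$, $\vec y=\langle y_0,\dots,y_{n-1}\rangle$, the $(\min,-)$ convolution has $k$th entry $\min_{i=0}^{k}(x_i-y_{k-i})$, $k=0,\dots,n-1$. -}

module Defs where

open import Algebra.Bundles using (CommutativeRing)
open import Algebra.Core using (Op₁)
import Algebra.Definitions.RawMonoid as RawMonoidDefinitions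
open import Data.Bool.Base using (if_then_else_)
open import Data.Fin.Base using (Fin; toℕ; inject≤; opposite)
open import Data.Fin.Properties using (toℕ<n)
open import Data.Nat.Base as ℕ using (ℕ; zero; suc)
import Data.Nat.Properties as ℕ
open import Data.Product.Base using (_×_; _,_; ∃; ∃₂; ∃-syntax)
open import Data.Unit.Base using (⊤)
open import Data.Vec.Functional using (Vector)
open import Level using (0ℓ)
open import Relation.Binary.Core using (Rel)
open import Relation.Binary.PropositionalEquality.Core using (_≡_)
open import Relation.Binary.Structures using (IsDecTotalOrder)
open import Relation.Nullary.Decidable.Core using (yes; no; does)
open import Relation.Nullary.Negation.Core using (¬_)
open import Relation.Unary using (Pred; Satisfiable)

------------------------------------------------------------------------
-- The real numbers, axiomatised as a complete ordered field

-- Decidability of the order is the classical trichotomy of ℝ.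

record RealNumbers : Set₁ where
  infix 4 _≤_
  infix 8 _⁻¹
  field
    commutativeRing : CommutativeRing 0ℓ 0ℓ

  open CommutativeRing commutativeRing public
    using (Carrier; _≈_; _+_; _*_; _-_; 0#; 1#; +-rawMonoid)

  field
    _⁻¹             : Op₁ Carrier        -- 0# ⁻¹ is left unspecified
    0≉1             : ¬ 0# ≈ 1#
    *-inverseʳ      : ∀ x → ¬ x ≈ 0# → x * x ⁻¹ ≈ 1#

    _≤_             : Rel Carrier 0ℓ
    isDecTotalOrder : IsDecTotalOrder _≈_ _≤_
    +-monoʳ-≤       : ∀ x {y z} → y ≤ z → x + y ≤ x + z
    *-nonNegative   : ∀ {x y} → 0# ≤ x → 0# ≤ y → 0# ≤ x * y

  UpperBound : Pred Carrier 0ℓ → Pred Carrier 0ℓ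
  UpperBound P u = ∀ {x} → P x → x ≤ u

  field
    supremum : (P : Pred Carrier 0ℓ) → Satisfiable P → Satisfiable (UpperBound P) →
               ∃[ s ] UpperBound P s × (∀ {u} → UpperBound P u → s ≤ u)

  open RawMonoidDefinitions +-rawMonoid using () renaming (_×_ to _·_)

  fromℕ : ℕ → Carrier
  fromℕ n = n · 1#

------------------------------------------------------------------------
-- Real RAM programs

-- A program mentions finitely many natural-number registers, real
-- registers, arrays of naturals and arrays of reals, each kind named by
-- numerals.  Array cells are addressed by naturals held in registers.
-- No operation (such as floor) turns a real into a natural.

Reg Arr : Set
Reg = ℕ
Arr = ℕ

data NatOp : Set where
  add monus mul : NatOp

data RealOp : Set where
  add sub mul div : RealOp

data Instruction : Set where
  constᴺ : (dst : Reg) (c : ℕ)                  → Instruction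
  opᴺ    : NatOp → (dst src₁ src₂ : Reg)        → Instruction
  loadᴺ  : (dst : Reg) (a : Arr) (idx : Reg)    → Instruction
  storeᴺ : (a : Arr) (idx : Reg) (src : Reg)    → Instruction
  castᴿ  : (dst : Reg) (src : Reg)              → Instruction
  opᴿ    : RealOp → (dst src₁ src₂ : Reg)       → Instruction
  loadᴿ  : (dst : Reg) (a : Arr) (idx : Reg)    → Instruction
  storeᴿ : (a : Arr) (idx : Reg) (src : Reg)    → Instruction

data Test : Set where
  _≤ᴺ_ _≤ᴿ_ : (r₁ r₂ : Reg) → Test

infixr 5 _⨾_

data Program : Set where
  skip  : Program
  exec  : Instruction → Program
  _⨾_   : Program → Program → Program
  if    : Test → Program → Program → Program
  while : Test → Program → Program

_[_≔_] : ∀ {A : Set} → (ℕ → A) → ℕ → A → (ℕ → A)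
(f [ k ≔ v ]) j = if does (j ℕ.≟ k) then v else f j

⟦_⟧ᴺ : NatOp → ℕ → ℕ → ℕ
⟦ add   ⟧ᴺ = ℕ._+_
⟦ monus ⟧ᴺ = ℕ._∸_
⟦ mul   ⟧ᴺ = ℕ._*_

------------------------------------------------------------------------
-- Asymptotics

⌈√_⌉ : ℕ → ℕ
⌈√ zero  ⌉ = zero
⌈√ suc n ⌉ with suc n ℕ.≤? ⌈√ n ⌉ ℕ.* ⌈√ n ⌉
... | yes _ = ⌈√ n ⌉
... | no  _ = suc ⌈√ n ⌉

n≤⌈√n⌉² : ∀ n → n ℕ.≤ ⌈√ n ⌉ ℕ.* ⌈√ n ⌉
n≤⌈√n⌉² zero    = ℕ.z≤n
n≤⌈√n⌉² (suc n) with suc n ℕ.≤? ⌈√ n ⌉ ℕ.* ⌈√ n ⌉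
... | yes p = p
... | no  _ = ℕ.s≤s (ℕ.≤-trans (n≤⌈√n⌉² n)
                (ℕ.≤-trans (ℕ.*-monoʳ-≤ ⌈√ n ⌉ (ℕ.n≤1+n ⌈√ n ⌉)) (ℕ.m≤n+m _ ⌈√ n ⌉)))

⌈√n⌉-least : ∀ n r → n ℕ.≤ r ℕ.* r → ⌈√ n ⌉ ℕ.≤ r
⌈√n⌉-least zero    r _ = ℕ.z≤n
⌈√n⌉-least (suc n) r n<r² with suc n ℕ.≤? ⌈√ n ⌉ ℕ.* ⌈√ n ⌉
... | yes _ = ⌈√n⌉-least n r (ℕ.<⇒≤ n<r²)
... | no  p = ℕ.≰⇒> λ r≤s → p (ℕ.≤-trans n<r² (ℕ.*-mono-≤ r≤s r≤s))

infix 4 _∈O_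

_∈O_ : (ℕ → ℕ) → (ℕ → ℕ) → Set
f ∈O g = ∃₂ λ C N → ∀ n → N ℕ.≤ n → f n ℕ.≤ C ℕ.* g n

------------------------------------------------------------------------

module RealRAM (R : RealNumbers) where
  open RealNumbers R

  Matrix : ℕ → ℕ → Set
  Matrix a b = Vector (Vector Carrier b) a

  IsMinimumOf : {I : Set} → (I → Carrier) → Carrier → Set
  IsMinimumOf f v = (∃[ i ] v ≈ f i) × (∀ i → v ≤ f i)

  IsMinMinusProduct : ∀ {a b c} → Matrix a b → Matrix b c → Matrix a c → Set
  IsMinMinusProduct A B P = ∀ i j → IsMinimumOf (λ m → A i m - B m j) (P i j)

  -- For i : Fin (suc k), toℕ (opposite i) is k ∸ toℕ i.

  IsMinMinusConvolution : ∀ {n} (x y z : Vector Carrier n) → Set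
  IsMinMinusConvolution x y z = ∀ k → IsMinimumOf {Fin (suc (toℕ k))}
    (λ i → x (inject≤ i (toℕ<n k)) - y (inject≤ (opposite i) (toℕ<n k))) (z k)

  ----------------------------------------------------------------------
  -- Unit-cost semantics

  record State : Set where
    field
      nreg : Reg → ℕ
      rreg : Reg → Carrier
      narr : Arr → ℕ → ℕ
      rarr : Arr → ℕ → Carrier

  open State public

  ⟦_⟧ᴿ : RealOp → Carrier → Carrier → Carrier
  ⟦ add ⟧ᴿ x y = x + y
  ⟦ sub ⟧ᴿ x y = x - y
  ⟦ mul ⟧ᴿ x y = x * y
  ⟦ div ⟧ᴿ x y = x * y ⁻¹

  -- Division by zero is the only instruction that gets stuck.

  Defined : Instruction → State → Set
  Defined (opᴿ div _ _ s₂) σ = ¬ rreg σ s₂ ≈ 0#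
  Defined _                _ = ⊤

  step : Instruction → State → State
  step (constᴺ d c)     σ = record σ { nreg = nreg σ [ d ≔ c ] }
  step (opᴺ o d s₁ s₂)  σ = record σ { nreg = nreg σ [ d ≔ ⟦ o ⟧ᴺ (nreg σ s₁) (nreg σ s₂) ] }
  step (loadᴺ d a i)    σ = record σ { nreg = nreg σ [ d ≔ narr σ a (nreg σ i) ] }
  step (storeᴺ a i s)   σ = record σ { narr = narr σ [ a ≔ narr σ a [ nreg σ i ≔ nreg σ s ] ] }
  step (castᴿ d s)      σ = record σ { rreg = rreg σ [ d ≔ fromℕ (nreg σ s) ] }
  step (opᴿ o d s₁ s₂)  σ = record σ { rreg = rreg σ [ d ≔ ⟦ o ⟧ᴿ (rreg σ s₁) (rreg σ s₂) ] }
  step (loadᴿ d a i)    σ = record σ { rreg = rreg σ [ d ≔ rarr σ a (nreg σ i) ] }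
  step (storeᴿ a i s)   σ = record σ { rarr = rarr σ [ a ≔ rarr σ a [ nreg σ i ≔ rreg σ s ] ] }

  Holds : Test → State → Set
  Holds (r₁ ≤ᴺ r₂) σ = nreg σ r₁ ℕ.≤ nreg σ r₂
  Holds (r₁ ≤ᴿ r₂) σ = rreg σ r₁ ≤ rreg σ r₂

  infix 4 ⟨_,_⟩⇓[_]_

  -- ⟨ p , σ ⟩⇓[ t ] τ: started in σ, p halts in τ after t instructions and tests.

  data ⟨_,_⟩⇓[_]_ : Program → State → ℕ → State → Set where
    skip⇓  : ∀ {σ} → ⟨ skip , σ ⟩⇓[ 0 ] σ
    exec⇓  : ∀ {ι σ} → Defined ι σ → ⟨ exec ι , σ ⟩⇓[ 1 ] step ι σ
    seq⇓   : ∀ {p q σ τ υ t u} → ⟨ p , σ ⟩⇓[ t ] τ → ⟨ q , τ ⟩⇓[ u ] υ →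
             ⟨ p ⨾ q , σ ⟩⇓[ t ℕ.+ u ] υ
    then⇓  : ∀ {b p q σ τ t} → Holds b σ → ⟨ p , σ ⟩⇓[ t ] τ → ⟨ if b p q , σ ⟩⇓[ suc t ] τ
    else⇓  : ∀ {b p q σ τ t} → ¬ Holds b σ → ⟨ q , σ ⟩⇓[ t ] τ → ⟨ if b p q , σ ⟩⇓[ suc t ] τ
    loop⇓  : ∀ {b p σ τ υ t u} → Holds b σ → ⟨ p , σ ⟩⇓[ t ] τ → ⟨ while b p , τ ⟩⇓[ u ] υ →
             ⟨ while b p , σ ⟩⇓[ suc (t ℕ.+ u) ] υ
    done⇓  : ∀ {b p σ} → ¬ Holds b σ → ⟨ while b p , σ ⟩⇓[ 1 ] σ

  ----------------------------------------------------------------------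
  -- Problems solvable within a worst-case time bound

  StoresVector : ∀ {n} → State → Arr → Vector Carrier n → Set
  StoresVector σ a x = ∀ i → rarr σ a (toℕ i) ≈ x i

  -- Row-major.

  StoresMatrix : ∀ {a b} → State → Arr → Matrix a b → Set
  StoresMatrix {b = b} σ a A = ∀ i j → rarr σ a (toℕ i ℕ.* b ℕ.+ toℕ j) ≈ A i j

  -- Convention for both problems: the size is in natural register 0, the
  -- operands are in real arrays 0 and 1, and the result is returned in real
  -- array 2.  All other memory is uninitialised, i.e. arbitrary.

  MinMinusProductInTime : (ℕ → ℕ) → Set
  MinMinusProductInTime T =
    ∃[ p ] ∀ m (A B : Matrix m m) σ →
      nreg σ 0 ≡ m → StoresMatrix σ 0 A → StoresMatrix σ 1 B →
      ∃₂ λ t τ → ⟨ p , σ ⟩⇓[ t ] τ × t ℕ.≤ T m ×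
        (∃[ P ] IsMinMinusProduct A B P × StoresMatrix τ 2 P)

  MinMinusConvolutionInTime : (ℕ → ℕ) → Set
  MinMinusConvolutionInTime T =
    ∃[ p ] ∀ n (x y : Vector Carrier n) σ →
      nreg σ 0 ≡ n → StoresVector σ 0 x → StoresVector σ 1 y →
      ∃₂ λ t τ → ⟨ p , σ ⟩⇓[ t ] τ × t ℕ.≤ T n ×
        (∃[ z ] IsMinMinusConvolution x y z × StoresVector τ 2 z)

-- With m = ⌈√ n ⌉, write positions as k = s m + t with s, t < m.  For each t,
-- the product of A[q,r] = x[q m + r] and B[r,u] = y[u m + t − r] gives, in
-- entry (q, s − q), the minimum of x[i] − y[k − i] over the block i = q m + r.
-- For q < s every such index is legitimate, so z[k] is the least of these s
-- entries and of the t + 1 differences with s m ≤ i ≤ k, taken directly.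
-- Entries reading beyond the operands contain junk but are never consulted,
-- so no infinite padding is needed.

module Submission where

open import Defs
open import Algebra.Bundles using (CommutativeRing)
open import Data.Nat.Base
  using (ℕ; zero; suc; _+_; _*_; _∸_; _⊔_; _≤_; _<_; z≤n; s≤s; NonZero; >-nonZero)
open import Data.Nat.Properties hiding (_≟_)
import Data.Nat.Properties as ℕ
open import Data.Nat.DivMod using (_/_; _%_; m≡m%n+[m/n]*n; m%n<n; m<n⇒m%n≡m; [m+kn]%n≡m%n; m<n*o⇒m/o<n)
open import Data.Nat.Tactic.RingSolver using (solve-∀)
open import Data.Bool.Base using (if_then_else_)
open import Data.Empty using (⊥; ⊥-elim)
open import Data.Fin.Base using (Fin; toℕ; fromℕ<; inject≤; opposite)
open import Data.Fin.Properties using (toℕ<n; toℕ-fromℕ<; toℕ-inject≤; opposite-prop)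
open import Data.List.Base using (List; []; _∷_; length)
open import Data.Product.Base using (_×_; _,_; proj₁; proj₂; ∃₂; ∃-syntax)
open import Data.Sum.Base using (inj₁; inj₂)
open import Data.Unit.Base using (⊤; tt)
open import Data.Vec.Functional using (Vector)
open import Function.Base using (id)
open import Relation.Binary.PropositionalEquality
  using (_≡_; _≢_; refl; sym; trans; cong; cong₂; cong-app; subst; subst₂; module ≡-Reasoning)
open import Relation.Binary.Structures using (IsDecTotalOrder)
open import Relation.Binary.Definitions using (tri<; tri≈; tri>)
open import Relation.Nullary.Decidable using (Dec; does; yes; no; dec-true; dec-false)
open import Relation.Nullary.Negation.Core using (¬_)

-- Fixing t makes a matrix product applicable: for i = q m + r the index k - i is (s - q) m + t - r,
-- so x enters through q and r, y through s - q and r, and the minimum over r is an inner dimension.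
-- Since B depends on t, there are m products, one per residue. All calls have size exactly m, so T
-- enters only as T(m). Each of the m rounds adds O(m²) work for building the inputs and scanning
-- the output, and m² ≤ 3n turns the total m (O(m²) + T(m)) into the claimed bound. The obstacle on
-- the machine side is that the product program is arbitrary and may destroy its inputs and any
-- memory it names. The proof therefore needs a frame property of all programs, and a loop rule
-- under which results of earlier rounds outlive later ones.

update-same : ∀ {A : Set} (f : ℕ → A) k v → (f [ k ≔ v ]) k ≡ v
update-same f k v rewrite dec-true (k ℕ.≟ k) refl = refl

update-other : ∀ {A : Set} (f : ℕ → A) {j k v} → j ≢ k → (f [ k ≔ v ]) j ≡ f j
update-other f {j} {k} j≢k rewrite dec-false (j ℕ.≟ k) j≢k = refl

-- Writing a correct value is harmless even to a cell that is already correct, so invariants stated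
-- cell by cell survive a write without any argument that the cells are distinct.
update-preserves : ∀ {A : Set} (P : ℕ → A → Set) (f : ℕ → A) {k v} → P k v →
                   ∀ j → P j (f j) → P j ((f [ k ≔ v ]) j)
update-preserves P f {k} {v} pk j pj = by-cases (j ℕ.≟ k)
  where
  by-cases : Dec (j ≡ k) → P j ((f [ k ≔ v ]) j)
  by-cases (yes refl) = subst (P k) (sym (update-same f k v)) pk
  by-cases (no j≢k)   = subst (P j) (sym (update-other f j≢k)) pj

update-cong : ∀ {A : Set} {f g : ℕ → A} {k l v} → k ≡ l → (∀ i → f i ≡ g i) →
              ∀ i → (f [ k ≔ v ]) i ≡ (g [ l ≔ v ]) i
update-cong {k = k} {v = v} refl f≡g i = cong (if does (i ℕ.≟ k) then v else_) (f≡g i)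

-- Arithmetic of the positions q m + r

position-mono : ∀ {q s m r t} → q < s → r < m → q * m + r < s * m + t
position-mono {q} {s} {m} {r} {t} q<s r<m = begin-strict
  q * m + r  <⟨ +-monoʳ-< (q * m) r<m ⟩
  q * m + m  ≡⟨ +-comm (q * m) m ⟩
  suc q * m  ≤⟨ *-monoˡ-≤ m q<s ⟩
  s * m      ≤⟨ m≤m+n (s * m) t ⟩
  s * m + t  ∎
  where open ≤-Reasoning

-- Successive truncated subtractions subtract the sum, so truncation does no harm; q ≤ s is what
-- lets t be moved past the subtraction of q m.
blockOffset : ∀ {q s} m r t → q ≤ s → (s ∸ q) * m + t ∸ r ≡ s * m + t ∸ (q * m + r)
blockOffset {q} {s} m r t q≤s = begin
  (s ∸ q) * m + t ∸ r        ≡⟨ cong (λ v → v + t ∸ r) (*-distribʳ-∸ m s q) ⟩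
  s * m ∸ q * m + t ∸ r      ≡⟨ cong (_∸ r) (+-∸-comm t (*-monoˡ-≤ m q≤s)) ⟨
  s * m + t ∸ q * m ∸ r      ≡⟨ ∸-+-assoc (s * m + t) (q * m) r ⟩
  s * m + t ∸ (q * m + r)    ∎
  where open ≡-Reasoning

position-injective : ∀ {m r u r′ u′} → u < m → u′ < m → r * m + u ≡ r′ * m + u′ → r ≡ r′ × u ≡ u′
position-injective {m} {r} {u} {r′} {u′} u<m u′<m eq = r≡r′ , u≡u′
  where
  instance
    m≢0 : NonZero m
    m≢0 = >-nonZero (≤-trans (s≤s z≤n) u<m)
  remainder : ∀ r {u} → u < m → (r * m + u) % m ≡ u
  remainder r {u} u<m = trans (cong (_% m) (+-comm (r * m) u))
    (trans ([m+kn]%n≡m%n u r m) (m<n⇒m%n≡m u<m))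
  u≡u′ : u ≡ u′
  u≡u′ = trans (sym (remainder r u<m)) (trans (cong (_% m) eq) (remainder r′ u′<m))
  r≡r′ : r ≡ r′
  r≡r′ = *-cancelʳ-≡ r r′ m (+-cancelʳ-≡ u (r * m) (r′ * m)
           (trans eq (cong (r′ * m +_) (sym u≡u′))))

-- Reassembles the results obtained per residue: quotient and remainder of k by m supply r and u.
all-positions : ∀ (P : ℕ → Set) {m} → (∀ {u} → u < m → ∀ {r} → r < m → P (r * m + u)) →
                ∀ {k} → k < m * m → P k
all-positions P {suc m} p {k} k<m² = subst P
  (sym (trans (m≡m%n+[m/n]*n k (suc m)) (+-comm (k % suc m) _)))
  (p (m%n<n k (suc m)) (m<n*o⇒m/o<n k<m²))

-- Derived program forms and their running times

block : List Instruction → Program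
block []       = skip
block (ι ∷ ιs) = exec ι ⨾ block ιs

-- The counter c runs down through b − 1, …, 0; register 1 is scratch.
for : Reg → Reg → Program → Program
for c b body =
  block (constᴺ 1 0 ∷ opᴺ add c b 1 ∷ constᴺ 1 1 ∷ []) ⨾
  while (1 ≤ᴺ c) (exec (opᴺ monus c c 1) ⨾ body ⨾ exec (constᴺ 1 1))

-- Three initial instructions, the final failing test, and per iteration a test, the decrement, the
-- body and the reset of register 1, which the body may use as scratch.
forCost : ℕ → ℕ → ℕ
forCost k B = 3 + suc (k * suc (1 + (B + 1)))

forCost-mono : ∀ {k l B C} → k ≤ l → B ≤ C → forCost k B ≤ forCost l C
forCost-mono k≤l B≤C = +-monoʳ-≤ 4 (*-mono-≤ k≤l (s≤s (s≤s (+-monoˡ-≤ 1 B≤C))))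

-- Registers and arrays are not told apart: only a numeral beyond all those
-- assigned to by a program is needed.
target : Instruction → ℕ
target (constᴺ d _)   = d
target (opᴺ _ d _ _)  = d
target (loadᴺ d _ _)  = d
target (storeᴺ a _ _) = a
target (castᴿ d _)    = d
target (opᴿ _ d _ _)  = d
target (loadᴿ d _ _)  = d
target (storeᴿ a _ _) = a

targetBound : Program → ℕ
targetBound skip        = 0
targetBound (exec ι)    = suc (target ι)
targetBound (p ⨾ q)     = targetBound p ⊔ targetBound q
targetBound (if _ p q)  = targetBound p ⊔ targetBound q
targetBound (while _ p) = targetBound p

-- Register 3 holds one more than the square of register 4, since tests are
-- non-strict.
isqrt : Program
isqrt =
  block (constᴺ 1 1 ∷ constᴺ 4 0 ∷ constᴺ 3 1 ∷ []) ⨾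
  while (3 ≤ᴺ 0) (block (opᴺ add 4 4 1 ∷ opᴺ mul 3 4 4 ∷ opᴺ add 3 3 1 ∷ []))

copy : Arr → Arr → Program
copy src dst = for 2 3 (block (loadᴿ 0 src 2 ∷ storeᴿ dst 2 0 ∷ []))

isqrtCost setupCost shiftedCost prepareCost scanCost : ℕ → ℕ
isqrtCost m   = 3 + suc (m * 4)
setupCost m   = isqrtCost m + (1 + (forCost (m * m) 2 + (forCost (m * m) 2 + 2)))
shiftedCost m = forCost m (forCost m 7)
prepareCost m = 1 + (forCost (m * m) 2 + (shiftedCost m + 2))
scanCost m    = forCost m (6 + (forCost m 7 + (forCost m 6 + 1)))

roundCost convolutionCost : ℕ → ℕ → ℕ
roundCost m c       = prepareCost m + (c + scanCost m)
convolutionCost m c = setupCost m + (forCost m (roundCost m c) + (1 + forCost (m * m) 2))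

-- By leastness the predecessor m of the root has m² < n, hence also m ≤ n, and (m + 1)² = (m² + 1)
-- + 2m is at most 3n.
⌈√n⌉²≤n*3 : ∀ n → ⌈√ n ⌉ * ⌈√ n ⌉ ≤ n * 3
⌈√n⌉²≤n*3 n with ⌈√ n ⌉ in eq
... | zero  = z≤n
... | suc m = begin
  suc m * suc m              ≡⟨ expand m ⟩
  suc (m * m) + m + m        ≤⟨ +-mono-≤ (+-mono-≤ m²<n m≤n) m≤n ⟩
  n + n + n                  ≡⟨ triple n ⟩
  n * 3                      ∎
  where
  open ≤-Reasoning
  expand : ∀ m → suc m * suc m ≡ suc (m * m) + m + m
  expand = solve-∀
  triple : ∀ n → n + n + n ≡ n * 3
  triple = solve-∀
  m²<n : m * m < n
  m²<n = ≰⇒> λ n≤m² → <-irrefl refl (≤-trans (≤-reflexive (sym eq)) (⌈√n⌉-least n m n≤m²))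
  m≤m² : ∀ m → m ≤ m * m
  m≤m² zero      = z≤n
  m≤m² m@(suc _) = m≤m*n m m
  m≤n : m ≤ n
  m≤n = ≤-trans (m≤m² m) (<⇒≤ m²<n)

forCost≤ : ∀ k B .{{_ : NonZero k}} → forCost k B ≤ k * (7 + B)
forCost≤ k B = ≤-trans (+-monoˡ-≤ (k * suc (1 + (B + 1))) (m≤n*m 4 k)) (≤-reflexive (eq k B))
  where
  eq : ∀ k B → k * 4 + k * suc (1 + (B + 1)) ≡ k * (7 + B)
  eq = solve-∀

forCost≤² : ∀ k {B} b .{{_ : NonZero k}} → B ≤ k * b → forCost k B ≤ k * k * (7 + b)
forCost≤² k {B} b B≤ = begin
  forCost k B            ≤⟨ forCost≤ k B ⟩
  k * (7 + B)            ≤⟨ *-monoʳ-≤ k (+-mono-≤ (m≤n*m 7 k) B≤) ⟩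
  k * (k * 7 + k * b)    ≡⟨ eq k b ⟩
  k * k * (7 + b)        ∎
  where
  open ≤-Reasoning
  eq : ∀ k b → k * (k * 7 + k * b) ≡ k * k * (7 + b)
  eq = solve-∀

-- Since m ≥ 1, lower-order terms are absorbed into multiples of m². The 120 is 39 for setup and the
-- final copy, 7 for the overhead of the outer loop, and 74 = 33 + 41 for preparing and scanning in
-- a round.
convolutionCost≤ : ∀ m c .{{_ : NonZero m}} → convolutionCost m c ≤ m * (m * m * 120 + c)
convolutionCost≤ m c = begin
  convolutionCost m c
    ≤⟨ +-mono-≤ setup≤ (+-mono-≤ (≤-trans (forCost≤ m _) (*-monoʳ-≤ m (+-mono-≤ (m≤n*m 7 S) round≤)))
                                 (+-mono-≤ (m≤n*m 1 S) copy≤)) ⟩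
  S * 29 + (m * (S * 7 + (S * 74 + c)) + (S * 1 + S * 9))
    ≡⟨ regroup S (m * (S * 7 + (S * 74 + c))) ⟩
  S * 39 + m * (S * 7 + (S * 74 + c))
    ≤⟨ +-monoˡ-≤ _ (m≤n*m (S * 39) m) ⟩
  m * (S * 39) + m * (S * 7 + (S * 74 + c))
    ≡⟨ collect m S c ⟩
  m * (S * 120 + c) ∎
  where
  open ≤-Reasoning
  S : ℕ
  S = m * m
  instance
    S≢0 : NonZero S
    S≢0 = m*n≢0 m m
  regroup : ∀ S x → S * 29 + (x + (S * 1 + S * 9)) ≡ S * 39 + x
  regroup = solve-∀
  collect : ∀ m S c → m * (S * 39) + m * (S * 7 + (S * 74 + c)) ≡ m * (S * 120 + c)
  collect = solve-∀
  copy≤ : forCost S 2 ≤ S * 9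
  copy≤ = forCost≤ S 2
  setup≤ : setupCost m ≤ S * 29
  setup≤ = ≤-trans
    (+-mono-≤ (+-mono-≤ (m≤n*m 4 S) (*-monoˡ-≤ 4 (m≤m*n m m)))
      (+-mono-≤ (m≤n*m 1 S) (+-mono-≤ copy≤ (+-mono-≤ copy≤ (m≤n*m 2 S)))))
    (≤-reflexive (eq S))
    where
    eq : ∀ S → S * 4 + S * 4 + (S * 1 + (S * 9 + (S * 9 + S * 2))) ≡ S * 29
    eq = solve-∀
  prepare≤ : prepareCost m ≤ S * 33
  prepare≤ = ≤-trans
    (+-mono-≤ (m≤n*m 1 S) (+-mono-≤ copy≤ (+-mono-≤ (forCost≤² m 14 (forCost≤ m 7)) (m≤n*m 2 S))))
    (≤-reflexive (eq S))
    where
    eq : ∀ S → S * 1 + (S * 9 + (S * 21 + S * 2)) ≡ S * 33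
    eq = solve-∀
  scan≤ : scanCost m ≤ S * 41
  scan≤ = forCost≤² m 34 (≤-trans
    (+-mono-≤ (m≤n*m 6 m) (+-mono-≤ (forCost≤ m 7) (+-mono-≤ (forCost≤ m 6) (m≤n*m 1 m))))
    (≤-reflexive (eq m)))
    where
    eq : ∀ m → m * 6 + (m * 14 + (m * 13 + m * 1)) ≡ m * 34
    eq = solve-∀
  round≤ : roundCost m c ≤ S * 74 + c
  round≤ = ≤-trans (+-mono-≤ prepare≤ (+-monoʳ-≤ c scan≤)) (≤-reflexive (eq S c))
    where
    eq : ∀ S c → S * 33 + (c + S * 41) ≡ S * 74 + c
    eq = solve-∀

convolutionCost-O : ∀ (T : ℕ → ℕ) →
  (λ n → convolutionCost ⌈√ n ⌉ (T ⌈√ n ⌉)) ∈O (λ n → (n + T ⌈√ n ⌉) * ⌈√ n ⌉)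
-- 360 = 3 · 120, the 3 coming from m² ≤ 3n; the threshold 1 makes m nonzero.
convolutionCost-O T = 360 , 1 , bound
  where
  open ≤-Reasoning
  rearrange : ∀ n m c → m * (n * 3 * 120 + c * 360) ≡ 360 * ((n + c) * m)
  rearrange = solve-∀
  bound : ∀ n → 1 ≤ n → convolutionCost ⌈√ n ⌉ (T ⌈√ n ⌉) ≤ 360 * ((n + T ⌈√ n ⌉) * ⌈√ n ⌉)
  bound n 1≤n = begin
    convolutionCost m c            ≤⟨ convolutionCost≤ m c ⟩
    m * (m * m * 120 + c)          ≤⟨ *-monoʳ-≤ m (+-mono-≤ (*-monoˡ-≤ 120 (⌈√n⌉²≤n*3 n)) (m≤m*n c 360)) ⟩
    m * (n * 3 * 120 + c * 360)    ≡⟨ rearrange n m c ⟩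
    360 * ((n + c) * m)            ∎
    where
    m c : ℕ
    m = ⌈√ n ⌉
    c = T m
    instance
      m≢0 : NonZero m
      m≢0 = >-nonZero (n≢0⇒n>0 λ m≡0 →
        <⇒≱ 1≤n (subst (λ m → n ≤ m * m) m≡0 (n≤⌈√n⌉² n)))

-- The convolution program

module Programs (product : Program) where

  -- The given program may overwrite anything below its target bound, so what
  -- must survive a call lives above it.  The literal 20 makes comparisons with
  -- the registers named by small literals compute.
  fresh tReg mReg : Reg
  fresh = 20 + targetBound product
  tReg = fresh
  mReg = suc fresh

  XA YA ZA : Arr
  XA = fresh
  YA = suc fresh
  ZA = suc (suc fresh)

  setup : Program
  setup =
    isqrt ⨾ exec (opᴺ mul 3 4 4) ⨾ copy 0 XA ⨾ copy 1 YA ⨾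
    block (constᴺ 1 0 ∷ opᴺ add mReg 4 1 ∷ [])

  shiftedCell : List Instruction
  shiftedCell =
    opᴺ mul 5 2 mReg ∷ opᴺ add 5 5 tReg ∷ opᴺ monus 5 5 4 ∷ loadᴿ 0 YA 5 ∷
    opᴺ mul 6 4 mReg ∷ opᴺ add 6 6 2 ∷ storeᴿ 1 6 0 ∷ []

  shiftedRow shifted : Program
  shiftedRow = for 2 mReg (block shiftedCell)
  shifted    = for 4 mReg shiftedRow

  -- A is the same in every round, but it is copied afresh because the previous call may have
  -- overwritten it.
  prepare : Program
  prepare = exec (opᴺ mul 3 mReg mReg) ⨾ copy XA 0 ⨾ shifted ⨾ block (constᴺ 1 0 ∷ opᴺ add 0 mReg 1 ∷ [])

  -- The real instruction set has no move, so ι recomputes the candidate of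
  -- register 2 directly into the running minimum in register 3.
  relax : Instruction → Program
  relax ι = if (2 ≤ᴿ 3) (exec ι) skip

  -- The running minimum starts from the term i = k, which always exists, so no infinite initial
  -- value is needed and the direct loop covers only r < t.
  scanStart directCell blockCell : List Instruction
  scanStart  = opᴺ mul 5 4 mReg ∷ opᴺ add 7 5 tReg ∷ constᴺ 6 0 ∷
               loadᴿ 0 XA 7 ∷ loadᴿ 1 YA 6 ∷ opᴿ sub 3 0 1 ∷ []
  directCell = opᴺ add 6 5 2 ∷ opᴺ monus 8 7 6 ∷ loadᴿ 0 XA 6 ∷ loadᴿ 1 YA 8 ∷ opᴿ sub 2 0 1 ∷ []
  blockCell  = opᴺ mul 6 2 mReg ∷ opᴺ monus 8 4 2 ∷ opᴺ add 6 6 8 ∷ loadᴿ 2 2 6 ∷ []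

  direct blocks scanEntry scan : Program
  direct    = for 2 tReg (block directCell ⨾ relax (opᴿ sub 3 0 1))
  blocks    = for 2 4 (block blockCell ⨾ relax (loadᴿ 3 2 6))
  scanEntry = block scanStart ⨾ direct ⨾ blocks ⨾ exec (storeᴿ ZA 7 3)
  scan      = for 4 mReg scanEntry

  convolution : Program
  convolution =
    setup ⨾ for tReg mReg (prepare ⨾ product ⨾ scan) ⨾ exec (opᴺ mul 3 mReg mReg) ⨾ copy ZA 2

-- Total-correctness rules with time bounds

module Semantics (R : RealNumbers) where
  open RealNumbers R using (commutativeRing; Carrier; _≈_; _-_; isDecTotalOrder)
    renaming (_≤_ to _≤ʳ_)
  open RealRAM R
  open CommutativeRing commutativeRing using (reflexive; +-cong; -‿cong)
    renaming (refl to ≈-refl; trans to ≈-trans)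

  setᴺ : State → Reg → ℕ → State
  setᴺ σ r v = record σ { nreg = nreg σ [ r ≔ v ] }

  record Runs (p : Program) (σ : State) (t : ℕ) (Q : State → Set) : Set where
    constructor runs
    field
      {time}     : ℕ
      {final}    : State
      derivation : ⟨ p , σ ⟩⇓[ time ] final
      time≤      : time ≤ t
      post       : Q final

  weaken : ∀ {p σ t u} {P Q : State → Set} → t ≤ u → (∀ {τ} → P τ → Q τ) →
           Runs p σ t P → Runs p σ u Q
  weaken t≤u f (runs d t′ q) = runs d (≤-trans t′ t≤u) (f q)

  run-exec : ∀ {ι σ Q} → Defined ι σ → Q (step ι σ) → Runs (exec ι) σ 1 Q
  run-exec def q = runs (exec⇓ def) ≤-refl q

  infixr 5 _then_
  _then_ : ∀ {p q σ t u P Q} → Runs p σ t P → (∀ {τ} → P τ → Runs q τ u Q) → Runs (p ⨾ q) σ (t + u) Q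
  runs d t≤ p then f with runs e u≤ q ← f p = runs (seq⇓ d e) (+-mono-≤ t≤ u≤) q

  run-step : ∀ {ι q σ u Q} → Defined ι σ → Runs q (step ι σ) u Q → Runs (exec ι ⨾ q) σ (suc u) Q
  run-step def (runs d u≤ q) = runs (seq⇓ (exec⇓ def) d) (s≤s u≤) q

  AlwaysDefined : List Instruction → Set
  AlwaysDefined []       = ⊤
  AlwaysDefined (ι ∷ ιs) = (∀ σ → Defined ι σ) × AlwaysDefined ιs

  steps : List Instruction → State → State
  steps []       σ = σ
  steps (ι ∷ ιs) σ = steps ιs (step ι σ)

  block⇓ : ∀ ιs {_ : AlwaysDefined ιs} {σ} → ⟨ block ιs , σ ⟩⇓[ length ιs ] steps ιs σ
  block⇓ []                      = skip⇓
  block⇓ (ι ∷ ιs) {def , defs} {σ} = seq⇓ (exec⇓ (def σ)) (block⇓ ιs {defs})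

  run-block : ∀ ιs {defs : AlwaysDefined ιs} {σ Q} → Q (steps ιs σ) → Runs (block ιs) σ (length ιs) Q
  run-block ιs {defs} q = runs (block⇓ ιs {defs}) ≤-refl q

  infixr 5 _▸_
  _▸_ : ∀ ιs {defs : AlwaysDefined ιs} {σ q u Q} →
        Runs q (steps ιs σ) u Q → Runs (block ιs ⨾ q) σ (length ιs + u) Q
  _▸_ ιs {defs} (runs d u≤ q) = runs (seq⇓ (block⇓ ιs {defs}) d) (+-monoʳ-≤ (length ιs) u≤) q

  -- The index of `I` counts the iterations still to come: one family serves as invariant,
  -- termination measure and time bound.
  run-while : ∀ {b p B} (I : ℕ → State → Set) →
              (∀ {j σ} → I (suc j) σ → Holds b σ × Runs p σ B (I j)) →
              (∀ {σ} → I 0 σ → ¬ Holds b σ) →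
              ∀ j {σ} → I j σ → Runs (while b p) σ (suc (j * suc B)) (I 0)
  run-while I body exit zero    i = runs (done⇓ (exit i)) ≤-refl i
  run-while {B = B} I body exit (suc j) i
    with h , runs d t≤ i′ ← body i
    with runs e u≤ i″ ← run-while I body exit j i′
    = runs (loop⇓ h d e) (s≤s (≤-trans (+-mono-≤ t≤ u≤) (≤-reflexive (+-suc B (j * suc B))))) i″

  Stable : Reg → (State → Set) → Set
  Stable r P = ∀ {σ v} → P σ → P (setᴺ σ r v)

  -- `I` is the invariant and `Q i` the lasting result of iteration i. Stability is required because
  -- loop control overwrites register 1 and the counter; the body must restore the counter and keep
  -- the results of the other iterations.
  run-for : ∀ c b {body B k} (I : State → Set) (Q : ℕ → State → Set) →
            c ≢ 1 → b ≢ 1 →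
            Stable 1 I → Stable c I → (∀ {i} → Stable 1 (Q i)) → (∀ {i} → Stable c (Q i)) →
            (∀ {j σ} → j < k → nreg σ c ≡ j → I σ →
              Runs body σ B (λ τ → nreg τ c ≡ j × I τ × Q j τ × (∀ {i} → Q i σ → Q i τ))) →
            ∀ {σ} → nreg σ b ≡ k → I σ →
            Runs (for c b body) σ (forCost k B) (λ τ → I τ × (∀ {i} → i < k → Q i τ))
  run-for c b {body} {B} {k} I Q c≢1 b≢1 I₁ Iᶜ Q₁ Qᶜ run-body {σ₀} b≡k i₀ =
    (constᴺ 1 0 ∷ opᴺ add c b 1 ∷ constᴺ 1 1 ∷ []) ▸
    weaken ≤-refl (λ { (_ , _ , i , q , _) → i , q z≤n }) (run-while J iteration exit k
      ( trans (update-other (nreg σ₂) c≢1) (trans (update-same (nreg σ₁) c (nreg σ₁ b + 0))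
          (trans (+-identityʳ (nreg σ₁ b)) (trans (update-other (nreg σ₀) b≢1) b≡k)))
      , refl , I₁ (Iᶜ (I₁ i₀)) , (λ k≤i i<k → ⊥-elim (<⇒≱ i<k k≤i)) , ≤-refl))
    where
    σ₁ σ₂ : State
    σ₁ = setᴺ σ₀ 1 0
    σ₂ = step (opᴺ add c b 1) σ₁

    J : ℕ → State → Set
    -- As the counter descends, the iterations done are those with j ≤ i < k: none at j = k, all at
    -- j = 0.
    J j σ = nreg σ c ≡ j × nreg σ 1 ≡ 1 × I σ × (∀ {i} → j ≤ i → i < k → Q i σ) × j ≤ k

    iteration : ∀ {j σ} → J (suc j) σ →
                Holds (1 ≤ᴺ c) σ × Runs (exec (opᴺ monus c c 1) ⨾ body ⨾ exec (constᴺ 1 1)) σ (1 + (B + 1)) (J j)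
    iteration {j} {σ} (c≡ , one , i , q , j<k) =
      subst₂ _≤_ (sym one) (sym c≡) (s≤s z≤n) ,
      run-step tt
        (run-body j<k (trans (update-same (nreg σ) c _) (cong₂ _∸_ c≡ one)) (Iᶜ i)
         then λ { {τ} (c≡′ , i′ , qj , keep) → run-exec tt
           ( trans (update-other (nreg τ) c≢1) c≡′ , refl , I₁ i′
           , (λ j≤i i<k → Q₁ (visited qj keep j≤i i<k)) , <⇒≤ j<k) })
      where
      visited : ∀ {τ} → Q j τ → (∀ {i} → Q i (step (opᴺ monus c c 1) σ) → Q i τ) → ∀ {i} → j ≤ i → i < k → Q i τ
      visited qj keep j≤i i<k with m≤n⇒m<n∨m≡n j≤i
      ... | inj₁ j<i  = keep (Qᶜ (q j<i i<k))
      ... | inj₂ refl = qj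

    exit : ∀ {σ} → J 0 σ → ¬ Holds (1 ≤ᴺ c) σ
    exit (c≡ , one , _) h with () ← subst₂ _≤_ one c≡ h

  -- Memory beyond the reach of a program

  record Unchanged (K : ℕ) (σ τ : State) : Set where
    constructor unchanged
    field
      nreg≡ : ∀ {r} → K ≤ r → nreg τ r ≡ nreg σ r
      rarr≡ : ∀ {a} → K ≤ a → ∀ i → rarr τ a i ≡ rarr σ a i

  open Unchanged

  Unchanged-refl : ∀ {K σ} → Unchanged K σ σ
  Unchanged-refl = unchanged (λ _ → refl) (λ _ _ → refl)

  Unchanged-trans : ∀ {K σ τ υ} → Unchanged K σ τ → Unchanged K τ υ → Unchanged K σ υ
  Unchanged-trans (unchanged n a) (unchanged n′ a′) =
    unchanged (λ K≤ → trans (n′ K≤) (n K≤)) (λ K≤ i → trans (a′ K≤ i) (a K≤ i))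

  step-unchanged : ∀ {K} ι σ → target ι < K → Unchanged K σ (step ι σ)
  step-unchanged {K} ι σ d<K = unchanged (on-ℕ ι d<K) (on-ℝ ι d<K)
    where
    on-ℕ : ∀ ι → target ι < K → ∀ {r} → K ≤ r → nreg (step ι σ) r ≡ nreg σ r
    on-ℕ (constᴺ _ _)   d<K K≤r = update-other (nreg σ) (>⇒≢ (<-≤-trans d<K K≤r))
    on-ℕ (opᴺ _ _ _ _)  d<K K≤r = update-other (nreg σ) (>⇒≢ (<-≤-trans d<K K≤r))
    on-ℕ (loadᴺ _ _ _)  d<K K≤r = update-other (nreg σ) (>⇒≢ (<-≤-trans d<K K≤r))
    on-ℕ (storeᴺ _ _ _) d<K K≤r = refl
    on-ℕ (castᴿ _ _)    d<K K≤r = refl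
    on-ℕ (opᴿ _ _ _ _)  d<K K≤r = refl
    on-ℕ (loadᴿ _ _ _)  d<K K≤r = refl
    on-ℕ (storeᴿ _ _ _) d<K K≤r = refl

    on-ℝ : ∀ ι → target ι < K → ∀ {a} → K ≤ a → ∀ i → rarr (step ι σ) a i ≡ rarr σ a i
    on-ℝ (constᴺ _ _)   d<K K≤a i = refl
    on-ℝ (opᴺ _ _ _ _)  d<K K≤a i = refl
    on-ℝ (loadᴺ _ _ _)  d<K K≤a i = refl
    on-ℝ (storeᴺ _ _ _) d<K K≤a i = refl
    on-ℝ (castᴿ _ _)    d<K K≤a i = refl
    on-ℝ (opᴿ _ _ _ _)  d<K K≤a i = refl
    on-ℝ (loadᴿ _ _ _)  d<K K≤a i = refl
    on-ℝ (storeᴿ _ _ _) d<K K≤a i = cong-app (update-other (rarr σ) (>⇒≢ (<-≤-trans d<K K≤a))) i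

  -- Assigned numerals are fixed in the program text, only cell indices being computed; induction on
  -- the derivation thus covers the unknown product program too.
  frame : ∀ {p K σ t τ} → ⟨ p , σ ⟩⇓[ t ] τ → targetBound p ≤ K → Unchanged K σ τ
  frame skip⇓                       _  = Unchanged-refl
  frame (exec⇓ {ι} {σ} _)           p≤ = step-unchanged ι σ p≤
  frame (seq⇓ {p} {q} d e)          p≤ =
    Unchanged-trans (frame d (m⊔n≤o⇒m≤o (targetBound p) _ p≤)) (frame e (m⊔n≤o⇒n≤o (targetBound p) _ p≤))
  frame (then⇓ {p = p} _ d)         p≤ = frame d (m⊔n≤o⇒m≤o (targetBound p) _ p≤)
  frame (else⇓ {p = p} _ d)         p≤ = frame d (m⊔n≤o⇒n≤o (targetBound p) _ p≤)
  frame (loop⇓ _ d e)               p≤ = Unchanged-trans (frame d p≤) (frame e p≤)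
  frame (done⇓ _)                   _  = Unchanged-refl

  framed : ∀ {p K σ t Q} → targetBound p ≤ K → Runs p σ t Q → Runs p σ t (λ τ → Unchanged K σ τ × Q τ)
  framed p≤ (runs d t≤ q) = runs d t≤ (frame d p≤ , q)

  store-same : ∀ a i s σ j → rarr (step (storeᴿ a i s) σ) a j ≡ (rarr σ a [ nreg σ i ≔ rreg σ s ]) j
  store-same a i s σ j = cong-app (update-same (rarr σ) a (rarr σ a [ nreg σ i ≔ rreg σ s ])) j

  store-other : ∀ {a b} i s σ → b ≢ a → ∀ j → rarr (step (storeᴿ a i s) σ) b j ≡ rarr σ b j
  store-other i s σ b≢a j = cong-app (update-other (rarr σ) b≢a) j

  run-copy : ∀ {src dst N σ} → src ≢ dst → nreg σ 3 ≡ N →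
             Runs (copy src dst) σ (forCost N 2) (λ τ →
               (∀ {i} → i < N → rarr τ dst i ≡ rarr σ src i) ×
               (∀ {a} → a ≢ dst → ∀ i → rarr τ a i ≡ rarr σ a i) ×
               (∀ {r} → 2 < r → nreg τ r ≡ nreg σ r))
  run-copy {src} {dst} {N} {σ₀} src≢dst eq =
    weaken ≤-refl (λ { ((a , n) , q) → q , a , n })
      (run-for 2 3 I (λ i σ → rarr σ dst i ≡ rarr σ₀ src i) (λ ()) (λ ())
        (λ {σ} (a , n) → a , λ 2<r → trans (update-other (nreg σ) (>⇒≢ (<⇒≤ 2<r))) (n 2<r))
        (λ {σ} (a , n) → a , λ 2<r → trans (update-other (nreg σ) (>⇒≢ 2<r)) (n 2<r))
        id id
        (λ {j} {σ} _ c≡ (a , n) → run-block (loadᴿ 0 src 2 ∷ storeᴿ dst 2 0 ∷ [])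
          (let σ₁ = step (loadᴿ 0 src 2) σ
               P : ℕ → Carrier → Set
               P i v = v ≡ rarr σ₀ src i
               loaded : P (nreg σ 2) (rarr σ src (nreg σ 2))
               loaded = a src≢dst (nreg σ 2)
           in c≡
            , ((λ a≢dst i → trans (store-other 2 0 σ₁ a≢dst i) (a a≢dst i)) , n)
            , subst (λ i → rarr (step (storeᴿ dst 2 0) σ₁) dst i ≡ rarr σ₀ src i) c≡
                (trans (store-same dst 2 0 σ₁ (nreg σ 2)) (trans (update-same (rarr σ dst) _ _) loaded))
            , λ {i} q → trans (store-same dst 2 0 σ₁ i) (update-preserves P (rarr σ dst) loaded i q)))
        eq ((λ _ _ → refl) , (λ _ → refl)))
    where
    I : State → Set
    I σ = (∀ {a} → a ≢ dst → ∀ i → rarr σ a i ≡ rarr σ₀ a i) ×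
          (∀ {r} → 2 < r → nreg σ r ≡ nreg σ₀ r)

  -- With j the distance from register 4 to the root, leastness of the root forces the test while j
  -- > 0, and n ≤ ⌈√n⌉² refutes it at j = 0.
  run-isqrt : ∀ {n σ} → nreg σ 0 ≡ n →
              Runs isqrt σ (isqrtCost ⌈√ n ⌉) (λ τ → nreg τ 4 ≡ ⌈√ n ⌉ × rarr τ ≡ rarr σ)
  run-isqrt {n} {σ₀} eq =
    (constᴺ 1 1 ∷ constᴺ 4 0 ∷ constᴺ 3 1 ∷ []) ▸
    weaken ≤-refl (λ (m≡ , _ , _ , _ , a) → trans (sym (+-identityʳ _)) m≡ , a)
      (run-while I iteration (λ {σ} → exit {σ}) ⌈√ n ⌉ (refl , refl , refl , eq , refl))
    where
    I : ℕ → State → Set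
    I j σ = nreg σ 4 + j ≡ ⌈√ n ⌉ × nreg σ 3 ≡ nreg σ 4 * nreg σ 4 + 1 × nreg σ 1 ≡ 1 × nreg σ 0 ≡ n
            × rarr σ ≡ rarr σ₀

    iteration : ∀ {j σ} → I (suc j) σ → Holds (3 ≤ᴺ 0) σ × Runs _ σ 3 (I j)
    iteration {j} {σ} (m≡ , sq≡ , one , n≡ , a) =
      subst₂ _≤_ (trans (+-comm 1 _) (sym sq≡)) (sym n≡)
        (≰⇒> λ n≤ → m+1+n≰m (nreg σ 4) (≤-trans (≤-reflexive m≡) (⌈√n⌉-least n (nreg σ 4) n≤))) ,
      run-block (opᴺ add 4 4 1 ∷ opᴺ mul 3 4 4 ∷ opᴺ add 3 3 1 ∷ [])
        ( trans (cong (λ v → nreg σ 4 + v + j) one) (trans (+-assoc (nreg σ 4) 1 j) m≡)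
        , cong ((nreg σ 4 + nreg σ 1) * (nreg σ 4 + nreg σ 1) +_) one , one , n≡ , a)

    exit : ∀ {σ} → I 0 σ → ¬ Holds (3 ≤ᴺ 0) σ
    exit {σ} (m≡ , sq≡ , _ , n≡ , _) h = <⇒≱ (subst₂ _≤_ (trans sq≡ (+-comm _ 1)) n≡ h)
      (subst (λ m → n ≤ m * m) (trans (sym m≡) (+-identityʳ _)) (n≤⌈√n⌉² n))

  Minimum : (ℕ → Set) → (ℕ → Carrier) → Carrier → Set
  Minimum P f v = (∃[ i ] P i × v ≈ f i) × (∀ {i} → P i → v ≤ʳ f i)

  -- Correctness of one round and of the loop over t

  module Correctness (product : Program) (m : ℕ) (X Y : ℕ → Carrier) where
    open Programs product

    open IsDecTotalOrder isDecTotalOrder using (total)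
      renaming (_≤?_ to _≤ʳ?_; refl to ≤ʳ-refl; trans to ≤ʳ-trans; reflexive to ≤ʳ-reflexive)

    -- `X` and `Y` describe the saved arrays at every index, junk included, so reads carry no range
    -- conditions.
    Operands : State → Set
    Operands σ = nreg σ mReg ≡ m × (∀ i → rarr σ XA i ≡ X i) × (∀ i → rarr σ YA i ≡ Y i)

    difference : ℕ → ℕ → Carrier
    difference k i = X i - Y (k ∸ i)

    ConvolutionEntry : ℕ → Carrier → Set
    ConvolutionEntry k = Minimum (_≤ k) (difference k)

    -- Truncation can only occur in column u = 0, when r > t; the scan reads columns s - q with q <
    -- s, where u m + t ≥ m > r.
    ProductEntry : ℕ → ℕ → ℕ → Carrier → Set
    ProductEntry t q u = Minimum (_< m) (λ r → X (q * m + r) - Y (u * m + t ∸ r))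

    -- Quantifying over every decomposition of c makes the property one of the
    -- cell alone, hence preserved when any cell is overwritten correctly.
    ShiftedEntry : ℕ → ℕ → Carrier → Set
    ShiftedEntry t c v = ∀ r u → u < m → c ≡ r * m + u → v ≡ Y (u * m + t ∸ r)

    run-shifted : ∀ {t σ} → Operands σ → nreg σ tReg ≡ t →
                  Runs shifted σ (shiftedCost m) (λ τ →
                    (∀ {r u} → r < m → u < m → rarr τ 1 (r * m + u) ≡ Y (u * m + t ∸ r)) ×
                    (∀ i → rarr τ 0 i ≡ rarr σ 0 i) × Operands τ)
    run-shifted {t} {σ₀} operands t≡ =
      weaken ≤-refl (λ { ((ops , _ , a) , q) → (λ {r} {u} r<m u<m → q r<m u u<m r u u<m refl) , a , ops })
        (run-for 4 mReg I Row (λ ()) (λ ()) id id id id row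
          (proj₁ operands) (operands , t≡ , λ _ → refl))
      where
      I : State → Set
      I σ = Operands σ × nreg σ tReg ≡ t × (∀ i → rarr σ 0 i ≡ rarr σ₀ 0 i)

      Cell Row : ℕ → State → Set
      Cell c σ = ShiftedEntry t c (rarr σ 1 c)
      Row r σ = ∀ u → u < m → Cell (r * m + u) σ

      row : ∀ {r σ} → r < m → nreg σ 4 ≡ r → I σ →
            Runs shiftedRow σ (forCost m 7) (λ τ →
              nreg τ 4 ≡ r × I τ × Row r τ × (∀ {r′} → Row r′ σ → Row r′ τ))
      row {r} {σ₁} r<m r≡ i =
        weaken ≤-refl (λ { ((r≡ , i , keep) , q) → r≡ , i , (λ _ → q) , λ q′ u u<m → keep (q′ u u<m) })
          (run-for 2 mReg J (λ u → Cell (r * m + u)) (λ ()) (λ ()) id id id id cell (proj₁ (proj₁ i)) (r≡ , i , id))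
        where
        J : State → Set
        -- The last component speaks of every cell, so that rows finished earlier stay correct while
        -- this one is written.
        J σ = nreg σ 4 ≡ r × I σ × (∀ {c} → Cell c σ₁ → Cell c σ)

        cell : ∀ {u σ} → u < m → nreg σ 2 ≡ u → J σ →
               Runs (block shiftedCell) σ 7 (λ τ →
                 nreg τ 2 ≡ u × J τ × Cell (r * m + u) τ × (∀ {u′} → Cell (r * m + u′) σ → Cell (r * m + u′) τ))
        cell {u} {σ} u<m u≡ (r≡ , i@((m≡ , _ , Y≡) , t≡ , _) , keep) =
          run-block shiftedCell
            ( u≡ , (r≡ , i , λ {c} q → preserve c (keep q))
            , subst (λ c → ShiftedEntry t c (cells′ c)) c≡ preserve-at
            , λ {u′} → preserve (r * m + u′))
          where
          cells cells′ : ℕ → Carrier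
          cells = rarr σ 1
          cells′ = rarr (steps shiftedCell σ) 1

          c≡ : nreg σ 4 * nreg σ mReg + nreg σ 2 ≡ r * m + u
          c≡ = cong₂ _+_ (cong₂ _*_ r≡ m≡) u≡

          new : ShiftedEntry t (nreg σ 4 * nreg σ mReg + nreg σ 2)
                  (rarr σ YA (nreg σ 2 * nreg σ mReg + nreg σ tReg ∸ nreg σ 4))
          new r′ u′ u′<m eq
            with refl , refl ← position-injective {r = r} {r′ = r′} u<m u′<m (trans (sym c≡) eq)
            = trans (Y≡ _) (cong Y (cong₂ _∸_ (cong₂ _+_ (cong₂ _*_ u≡ m≡) t≡) r≡))

          preserve : ∀ c → ShiftedEntry t c (cells c) → ShiftedEntry t c (cells′ c)
          preserve = update-preserves (ShiftedEntry t) cells new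

          preserve-at : ShiftedEntry t _ (cells′ (nreg σ 4 * nreg σ mReg + nreg σ 2))
          preserve-at = subst (ShiftedEntry t _) (sym (update-same cells _ _)) new

    run-prepare : ∀ {t σ} → Operands σ → nreg σ tReg ≡ t →
                  Runs prepare σ (prepareCost m) (λ τ →
                    nreg τ 0 ≡ m ×
                    (∀ {i} → i < m * m → rarr τ 0 i ≡ X i) ×
                    (∀ {r u} → r < m → u < m → rarr τ 1 (r * m + u) ≡ Y (u * m + t ∸ r)))
    run-prepare {t} {σ} (m≡ , X≡ , Y≡) t≡ =
      run-step tt (run-copy (λ ()) (cong₂ _*_ m≡ m≡)
      then λ { (copied , others , regs) →
        run-shifted
          ( trans (regs (s≤s (s≤s (s≤s z≤n)))) m≡
          , (λ i → trans (others (λ ()) i) (X≡ i))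
          , (λ i → trans (others (λ ()) i) (Y≡ i)))
          (trans (regs (s≤s (s≤s (s≤s z≤n)))) t≡)
      then λ { (shift , same , (m≡ , _)) →
        run-block (constᴺ 1 0 ∷ opᴺ add 0 mReg 1 ∷ [])
          ( trans (+-identityʳ _) m≡
          , (λ {i} i< → trans (same i) (trans (copied i<) (X≡ i)))
          , shift) }})

    run-relax : ∀ {ι σ Q} → Defined ι σ →
                (rreg σ 2 ≤ʳ rreg σ 3 → Q (step ι σ)) → (rreg σ 3 ≤ʳ rreg σ 2 → Q σ) →
                Runs (relax ι) σ 2 Q
    run-relax {ι} {σ} def below above with rreg σ 2 ≤ʳ? rreg σ 3
    ... | yes d≤acc = runs (then⇓ d≤acc (exec⇓ def)) ≤-refl (below d≤acc)
    ... | no  d≰acc with total (rreg σ 2) (rreg σ 3)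
    ...   | inj₁ d≤acc = ⊥-elim (d≰acc d≤acc)
    ...   | inj₂ acc≤d = runs (else⇓ d≰acc skip⇓) (s≤s z≤n) (above acc≤d)

    Multiplied : ℕ → State → Set
    Multiplied t σ = Operands σ × nreg σ tReg ≡ t ×
                     (∀ {q u} → q < m → u < m → ProductEntry t q u (rarr σ 2 (q * m + u)))

    module Scan {s t : ℕ} (s<m : s < m) (t<m : t < m) (Z : ℕ → Carrier) where
      k : ℕ
      k = s * m + t

      Context : State → Set
      Context σ = Multiplied t σ × nreg σ 4 ≡ s × (∀ i → rarr σ ZA i ≡ Z i)

      Attained : Carrier → Set
      Attained v = ∃[ i ] i ≤ k × v ≈ difference k i

      -- The bound v records that register 3 never increases, which carries the inequalities won in
      -- one phase into the next.
      Scanning : Carrier → State → Set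
      Scanning v σ = (Context σ × nreg σ 5 ≡ s * m × nreg σ 7 ≡ k) × Attained (rreg σ 3) × rreg σ 3 ≤ʳ v

      run-direct : ∀ {v σ} → Scanning v σ →
                   Runs direct σ (forCost t 7) (λ τ →
                     Scanning v τ × (∀ {r} → r < t → rreg τ 3 ≤ʳ difference k (s * m + r)))
      run-direct {v} scanning@((((_ , t≡ , _) , _) , _) , _) =
        run-for 2 tReg (Scanning v) (λ r σ → rreg σ 3 ≤ʳ difference k (s * m + r)) (λ ()) (λ ())
          id id id id body t≡ scanning
        where
        body : ∀ {r σ} → r < t → nreg σ 2 ≡ r → Scanning v σ → Runs _ σ 7 (λ τ →
                 nreg τ 2 ≡ r × Scanning v τ × rreg τ 3 ≤ʳ difference k (s * m + r) ×
                 (∀ {i} → rreg σ 3 ≤ʳ difference k (s * m + i) → rreg τ 3 ≤ʳ difference k (s * m + i)))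
        body {r} {σ} r<t r≡ (ctx@((((_ , X≡ , Y≡) , _) , _) , 5≡ , 7≡) , attained , ≤v) =
          directCell ▸ run-relax tt
            (λ d≤acc → r≡ , (ctx , (s * m + r , +-monoʳ-≤ (s * m) (<⇒≤ r<t) , reflexive d≡)
                            , ≤ʳ-trans d≤acc ≤v)
                     , ≤ʳ-reflexive (reflexive d≡) , ≤ʳ-trans d≤acc)
            (λ acc≤d → r≡ , (ctx , attained , ≤v) , ≤ʳ-trans acc≤d (≤ʳ-reflexive (reflexive d≡)) , id)
          where
          i≡ : nreg σ 5 + nreg σ 2 ≡ s * m + r
          i≡ = cong₂ _+_ 5≡ r≡
          d≡ : rarr σ XA (nreg σ 5 + nreg σ 2) - rarr σ YA (nreg σ 7 ∸ (nreg σ 5 + nreg σ 2))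
               ≡ difference k (s * m + r)
          d≡ = cong₂ _-_ (trans (X≡ _) (cong X i≡)) (trans (Y≡ _) (cong Y (cong₂ _∸_ 7≡ i≡)))

      run-blocks : ∀ {v σ} → Scanning v σ →
                   Runs blocks σ (forCost s 6) (λ τ →
                     Scanning v τ × (∀ {q} → q < s → ∀ r → r < m → rreg τ 3 ≤ʳ difference k (q * m + r)))
      run-blocks {v} scanning@(((_ , s≡ , _) , _) , _) =
        run-for 2 4 (Scanning v) Q (λ ()) (λ ())
          id id id id body s≡ scanning
        where
        Below : ℕ → Carrier → Set
        Below q v = ∀ r → r < m → v ≤ʳ difference k (q * m + r)

        Q : ℕ → State → Set
        Q q σ = Below q (rreg σ 3)

        body : ∀ {q σ} → q < s → nreg σ 2 ≡ q → Scanning v σ → Runs _ σ 6 (λ τ →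
                 nreg τ 2 ≡ q × Scanning v τ × Q q τ × (∀ {q′} → Q q′ σ → Q q′ τ))
        body {q} {σ} q<s q≡ (ctx@((((m≡ , _) , _ , products) , s≡ , _) , _) , attained , ≤v) =
          blockCell ▸ run-relax tt
            (λ d≤acc → q≡ , (ctx , d-attained , ≤ʳ-trans d≤acc ≤v)
                     , d-below , λ below r r<m → ≤ʳ-trans d≤acc (below r r<m))
            (λ acc≤d → q≡ , (ctx , attained , ≤v)
                     , (λ r r<m → ≤ʳ-trans acc≤d (d-below r r<m)) , id)
          where
          d : Carrier
          d = rarr σ 2 (nreg σ 2 * nreg σ mReg + (nreg σ 4 ∸ nreg σ 2))

          entry : ProductEntry t q (s ∸ q) d
          entry = subst (λ i → ProductEntry t q (s ∸ q) (rarr σ 2 i))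
            (sym (cong₂ _+_ (cong₂ _*_ q≡ m≡) (cong₂ _∸_ s≡ q≡)))
            (products (<-trans q<s s<m) (≤-<-trans (m∸n≤m s q) s<m))

          entry≡ : ∀ r → X (q * m + r) - Y ((s ∸ q) * m + t ∸ r) ≡ difference k (q * m + r)
          entry≡ r = cong (λ i → X (q * m + r) - Y i) (blockOffset m r t (<⇒≤ q<s))

          d-attained : Attained d
          d-attained with (r , r<m , d≈) , _ ← entry =
            q * m + r , <⇒≤ (position-mono {t = t} q<s r<m) , ≈-trans d≈ (reflexive (entry≡ r))

          d-below : Below q d
          d-below r r<m = ≤ʳ-trans (proj₂ entry r<m) (≤ʳ-reflexive (reflexive (entry≡ r)))

      scanEntryCost : ℕ
      scanEntryCost = 6 + (forCost t 7 + (forCost s 6 + 1))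

      run-scanEntry : ∀ {σ} → Context σ →
                      Runs scanEntry σ scanEntryCost (λ τ →
                        Multiplied t τ × nreg τ 4 ≡ s ×
                        ∃[ v ] ConvolutionEntry k v × (∀ i → rarr τ ZA i ≡ (Z [ k ≔ v ]) i))
      run-scanEntry {σ} ctx@(((m≡ , X≡ , Y≡) , t≡ , _) , s≡ , _) =
        scanStart ▸
        run-direct
          ( (ctx , cong₂ _*_ s≡ m≡ , k≡)
          , (k , ≤-refl , reflexive start≡) , ≤ʳ-reflexive (reflexive start≡))
        then λ { {σ₁} (scanning₁ , ≤direct) →
        -- The bound is reset to the current minimum, to be chained with the direct inequalities
        -- afterwards.
        run-blocks (proj₁ scanning₁ , proj₁ (proj₂ scanning₁) , ≤ʳ-refl)
        then λ { {σ₂} (((((((m≡ , X≡ , Y≡) , t≡ , products) , s≡ , Z≡) , _ , k≡) , attained , ≤σ₁) , ≤blocks)) →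
        run-exec tt
          ( ( ( m≡
              , (λ i → trans (store-other 7 3 σ₂ (<⇒≢ (s≤s (n≤1+n _))) i) (X≡ i))
              , (λ i → trans (store-other 7 3 σ₂ (<⇒≢ ≤-refl) i) (Y≡ i)))
            , t≡ , products)
          , s≡ , rreg σ₂ 3
          , (attained , λ {i} i≤k → ≤all (≤ʳ-trans ≤σ₁ (proj₂ (proj₂ scanning₁)))
                                          (λ r<t → ≤ʳ-trans ≤σ₁ (≤direct r<t)) ≤blocks i≤k)
          , λ i → trans (store-same ZA 7 3 σ₂ i)
              (update-cong k≡ Z≡ i)) }}
        where
        k≡ : nreg σ 4 * nreg σ mReg + nreg σ tReg ≡ k
        k≡ = cong₂ _+_ (cong₂ _*_ s≡ m≡) t≡

        start≡ : rarr σ XA (nreg σ 4 * nreg σ mReg + nreg σ tReg) - rarr σ YA 0 ≡ difference k k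
        start≡ = cong₂ _-_ (trans (X≡ _) (cong X k≡)) (trans (Y≡ 0) (cong Y (sym (n∸n≡0 k))))

        -- Writing i = q m + r, the case q < s belongs to the blocks, q = s with r < t to the direct
        -- loop and r = t to the start; q > s would give i > k.
        ≤all : ∀ {v} → v ≤ʳ difference k k →
               (∀ {r} → r < t → v ≤ʳ difference k (s * m + r)) →
               (∀ {q} → q < s → ∀ r → r < m → v ≤ʳ difference k (q * m + r)) →
               ∀ {i} → i ≤ k → v ≤ʳ difference k i
        ≤all {v} ≤k ≤direct ≤blocks {i} i≤k = subst (λ i → v ≤ʳ difference k i) (sym i≡) below
          where
          instance
            m≢0 : NonZero m
            m≢0 = >-nonZero (≤-<-trans z≤n t<m)
          q r : ℕ
          q = i / m
          r = i % m
          i≡ : i ≡ q * m + r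
          i≡ = trans (m≡m%n+[m/n]*n i m) (+-comm r (q * m))
          below : v ≤ʳ difference k (q * m + r)
          below with <-cmp q s
          ... | tri< q<s _ _ = ≤blocks q<s r (m%n<n i m)
          ... | tri> _ _ s<q = ⊥-elim (<⇒≱ (<-≤-trans (position-mono {t = r} s<q t<m) (≤-reflexive (sym i≡))) i≤k)
          ... | tri≈ _ q≡s _ with m≤n⇒m<n∨m≡n (+-cancelˡ-≤ (s * m) r t
                                    (≤-trans (≤-reflexive (trans (cong (λ q → q * m + r) (sym q≡s)) (sym i≡))) i≤k))
          ...   | inj₁ r<t = subst (λ q → v ≤ʳ difference k (q * m + r)) (sym q≡s) (≤direct r<t)
          ...   | inj₂ r≡t = subst (λ i → v ≤ʳ difference k i) (sym (cong₂ (λ q r → q * m + r) q≡s r≡t)) ≤k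

    -- The last conjunct ranges over all positions, since the outer loop must keep the entries of
    -- other residues.
    run-scan : ∀ {t σ} → t < m → Multiplied t σ →
               Runs scan σ (scanCost m) (λ τ →
                 Multiplied t τ ×
                 (∀ {s} → s < m → ConvolutionEntry (s * m + t) (rarr τ ZA (s * m + t))) ×
                 (∀ k → ConvolutionEntry k (rarr σ ZA k) → ConvolutionEntry k (rarr τ ZA k)))
    run-scan {t} {σ₀} t<m mult@((m≡ , _) , _) =
      weaken ≤-refl (λ { ((mult , keep) , q) → mult , q , keep })
        (run-for 4 mReg I Q (λ ()) (λ ()) id id id id body m≡ (mult , λ _ → id))
      where
      I : State → Set
      I σ = Multiplied t σ × (∀ k → ConvolutionEntry k (rarr σ₀ ZA k) → ConvolutionEntry k (rarr σ ZA k))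

      Q : ℕ → State → Set
      Q s σ = ConvolutionEntry (s * m + t) (rarr σ ZA (s * m + t))

      body : ∀ {s σ} → s < m → nreg σ 4 ≡ s → I σ → Runs scanEntry σ _ (λ τ →
               nreg τ 4 ≡ s × I τ × Q s τ × (∀ {s′} → Q s′ σ → Q s′ τ))
      body {s} {σ} s<m s≡ (mult , keep) =
        weaken
          (+-monoʳ-≤ 6 (+-mono-≤ (forCost-mono {B = 7} (<⇒≤ t<m) ≤-refl)
            (+-monoˡ-≤ 1 (forCost-mono {B = 6} (<⇒≤ s<m) ≤-refl))))
          (λ { {τ} (mult , s≡ , v , entry , Z≡) →
            let preserve : ∀ k → ConvolutionEntry k (rarr σ ZA k) → ConvolutionEntry k (rarr τ ZA k)
                preserve k q = subst (ConvolutionEntry k) (sym (Z≡ k))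
                  (update-preserves ConvolutionEntry (rarr σ ZA) entry k q)
            in s≡
             , (mult , λ k q → preserve k (keep k q))
             , subst (ConvolutionEntry _) (sym (trans (Z≡ _) (update-same (rarr σ ZA) _ v))) entry
             , preserve _ })
          (run-scanEntry (mult , s≡ , λ _ → refl))
        where open Scan s<m t<m (rarr σ ZA)

    module Rounds (c : ℕ) (solves : ∀ (A B : Matrix m m) σ →
        nreg σ 0 ≡ m → StoresMatrix σ 0 A → StoresMatrix σ 1 B →
        ∃₂ λ t τ → ⟨ product , σ ⟩⇓[ t ] τ × t ≤ c ×
          (∃[ P ] IsMinMinusProduct A B P × StoresMatrix τ 2 P)) where

      run-product : ∀ {t σ} → nreg σ 0 ≡ m →
                    (∀ {i} → i < m * m → rarr σ 0 i ≡ X i) →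
                    (∀ {r u} → r < m → u < m → rarr σ 1 (r * m + u) ≡ Y (u * m + t ∸ r)) →
                    Runs product σ c (λ τ →
                      ∀ {q u} → q < m → u < m → ProductEntry t q u (rarr τ 2 (q * m + u)))
      run-product {t} {σ} m≡ X≡ Y≡ with solves A B σ m≡
          (λ i r → reflexive (X≡ (≤-trans (position-mono {t = 0} (toℕ<n i) (toℕ<n r)) (≤-reflexive (+-identityʳ _)))))
          (λ r u → reflexive (Y≡ (toℕ<n r) (toℕ<n u)))
        where
        A B : Matrix m m
        A i r = X (toℕ i * m + toℕ r)
        B r u = Y (toℕ u * m + t ∸ toℕ r)
      ... | _ , τ , d , t≤ , P , minimal , stored = runs d t≤ entries
        where
        entry : ∀ i j → ProductEntry t (toℕ i) (toℕ j) (rarr τ 2 (toℕ i * m + toℕ j))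
        entry i j with (r , P≈) , P≤ ← minimal i j =
          (toℕ r , toℕ<n r , ≈-trans (stored i j) P≈) ,
          λ {r} r<m → subst (λ r → rarr τ 2 _ ≤ʳ X (toℕ i * m + r) - Y (toℕ j * m + t ∸ r)) (toℕ-fromℕ< r<m)
            (≤ʳ-trans (≤ʳ-reflexive (stored i j)) (P≤ (fromℕ< r<m)))

        entries : ∀ {q u} → q < m → u < m → ProductEntry t q u (rarr τ 2 (q * m + u))
        entries q<m u<m = subst₂ (λ q u → ProductEntry t q u (rarr τ 2 (q * m + u)))
          (toℕ-fromℕ< q<m) (toℕ-fromℕ< u<m) (entry (fromℕ< q<m) (fromℕ< u<m))

      run-rounds : ∀ {σ} → Operands σ →
                   Runs (for tReg mReg (prepare ⨾ product ⨾ scan)) σ (forCost m (roundCost m c)) (λ τ →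
                     Operands τ × (∀ {t} → t < m → ∀ {s} → s < m →
                       ConvolutionEntry (s * m + t) (rarr τ ZA (s * m + t))))
      run-rounds operands =
        run-for tReg mReg Operands Q (λ ()) (λ ()) id
          (λ {σ} (m≡ , X≡ , Y≡) → trans (update-other (nreg σ) 1+n≢n) m≡ , X≡ , Y≡)
          id id body (proj₁ operands) operands
        where
        Q : ℕ → State → Set
        Q t σ = ∀ {s} → s < m → ConvolutionEntry (s * m + t) (rarr σ ZA (s * m + t))

        -- `prepare` assigns only to numerals given literally, so its bound computes and is compared
        -- with 20 by evaluation.
        low : targetBound prepare ≤ fresh
        low = ≤-trans (≤ᵇ⇒≤ (targetBound prepare) 20 tt) (m≤m+n 20 _)

        body : ∀ {t σ} → t < m → nreg σ tReg ≡ t → Operands σ → Runs (prepare ⨾ product ⨾ scan) σ (roundCost m c) (λ τ →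
                 nreg τ tReg ≡ t × Operands τ × Q t τ × (∀ {t′} → Q t′ σ → Q t′ τ))
        body {t} {σ} t<m t≡ (m≡ , X≡ , Y≡) =
          framed {K = fresh} low (run-prepare (m≡ , X≡ , Y≡) t≡)
          then λ { (same , size≡ , A≡ , B≡) →
          framed {K = fresh} (m≤n+m _ 20) (run-product size≡ A≡ B≡)
          then λ { (same′ , entries) →
          -- Operands, counter and earlier results thus all reach the scan intact.
          let u = Unchanged-trans same same′ in
          weaken ≤-refl
            (λ { ((operands , t≡ , _) , new , keep) →
                 t≡ , operands , new ,
                 λ q s<m → keep _ (subst (ConvolutionEntry _) (sym (rarr≡ u (m≤n+m _ 2) _)) (q s<m)) })
            (run-scan t<m
              ( ( trans (nreg≡ u (n≤1+n _)) m≡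
                , (λ i → trans (rarr≡ u ≤-refl i) (X≡ i))
                , (λ i → trans (rarr≡ u (n≤1+n _) i) (Y≡ i)))
              , trans (nreg≡ u ≤-refl) t≡ , entries)) }}

  -- Assembly of the whole program

  run-setup : ∀ product → let open Programs product in ∀ {n σ} → nreg σ 0 ≡ n →
              Runs setup σ (setupCost ⌈√ n ⌉) (λ τ →
                nreg τ mReg ≡ ⌈√ n ⌉ ×
                (∀ {i} → i < ⌈√ n ⌉ * ⌈√ n ⌉ → rarr τ XA i ≡ rarr σ 0 i) ×
                (∀ {i} → i < ⌈√ n ⌉ * ⌈√ n ⌉ → rarr τ YA i ≡ rarr σ 1 i))
  run-setup product n≡ =
    run-isqrt n≡
    then λ { (m≡ , arrays≡) → run-step tt (
    run-copy (λ ()) (cong₂ _*_ m≡ m≡)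
    then λ { (X≡ , others , regs) →
    run-copy (λ ()) (trans (regs (s≤s (s≤s (s≤s z≤n)))) (cong₂ _*_ m≡ m≡))
    then λ { {τ} (Y≡ , others′ , regs′) →
    run-block (constᴺ 1 0 ∷ opᴺ add mReg 4 1 ∷ [])
      ( trans (update-same (nreg (setᴺ τ 1 0)) mReg _)
          (trans (+-identityʳ _) (trans (regs′ (s≤s (s≤s (s≤s z≤n)))) (trans (regs (s≤s (s≤s (s≤s z≤n)))) m≡)))
      , (λ {i} i< → trans (others′ (<⇒≢ ≤-refl) i) (trans (X≡ i<) (cong (λ a → a 0 i) arrays≡)))
      , (λ {i} i< → trans (Y≡ i<) (trans (others (λ ()) i) (cong (λ a → a 1 i) arrays≡)))) }})}
    where open Programs product

  -- Agreement with x and y is available only below n; this suffices because i and k - i are at most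
  -- k < n.
  entries⇒convolution : ∀ {n} (x y z : Vector Carrier n) (X Y : ℕ → Carrier) →
    (∀ i → X (toℕ i) ≈ x i) → (∀ i → Y (toℕ i) ≈ y i) →
    (∀ k → Minimum (_≤ toℕ k) (λ i → X i - Y (toℕ k ∸ i)) (z k)) →
    IsMinMinusConvolution x y z
  entries⇒convolution x y z X Y X≈ Y≈ entries k = attained (proj₁ (entries k)) , below
    where
    open IsDecTotalOrder isDecTotalOrder using () renaming (trans to ≤ʳ-trans; reflexive to ≤ʳ-reflexive)

    term : Fin (suc (toℕ k)) → Carrier
    term i = x (inject≤ i (toℕ<n k)) - y (inject≤ (opposite i) (toℕ<n k))

    term≈ : ∀ i → X (toℕ i) - Y (toℕ k ∸ toℕ i) ≈ term i
    term≈ i = +-cong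
      (≈-trans (reflexive (cong X (sym (toℕ-inject≤ i (toℕ<n k))))) (X≈ _))
      (-‿cong (≈-trans (reflexive (cong Y (sym (trans (toℕ-inject≤ (opposite i) (toℕ<n k)) (opposite-prop i))))) (Y≈ _)))

    attained : (∃[ i ] i ≤ toℕ k × z k ≈ X i - Y (toℕ k ∸ i)) → ∃[ i ] z k ≈ term i
    attained (i , i≤k , z≈) = fromℕ< (s≤s i≤k) , ≈-trans z≈ (≈-trans
      (reflexive (cong (λ i → X i - Y (toℕ k ∸ i)) (sym (toℕ-fromℕ< (s≤s i≤k)))))
      (term≈ (fromℕ< (s≤s i≤k))))

    below : ∀ i → z k ≤ʳ term i
    below i = ≤ʳ-trans (proj₂ (entries k) (≤-pred (toℕ<n i))) (≤ʳ-reflexive (term≈ i))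

  convolution-correct : ∀ {T} → MinMinusProductInTime T →
    MinMinusConvolutionInTime (λ n → convolutionCost ⌈√ n ⌉ (T ⌈√ n ⌉))
  convolution-correct {T} (product , solves) = convolution , correct
    where
    open Programs product
    correct : ∀ n (x y : Vector Carrier n) σ → nreg σ 0 ≡ n → StoresVector σ 0 x → StoresVector σ 1 y →
      ∃₂ λ t τ → ⟨ convolution , σ ⟩⇓[ t ] τ × t ≤ convolutionCost ⌈√ n ⌉ (T ⌈√ n ⌉) ×
        (∃[ z ] IsMinMinusConvolution x y z × StoresVector τ 2 z)
    correct n x y σ₀ n≡ x≈ y≈ = result main
      where
      m : ℕ
      m = ⌈√ n ⌉

      k<m² : ∀ (k : Fin n) → toℕ k < m * m
      k<m² k = <-≤-trans (toℕ<n k) (n≤⌈√n⌉² n)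

      Solved : State → Set
      Solved τ = ∃[ z ] IsMinMinusConvolution x y z × StoresVector τ 2 z

      main : Runs convolution σ₀ (convolutionCost m (T m)) Solved
      main =
        run-setup product n≡
        then λ { {σ₁} (m≡ , X≡ , Y≡) →
          -- Taking the saved arrays themselves as `X` and `Y` gives names to the junk beyond the
          -- operands.
          let open Correctness product m (rarr σ₁ XA) (rarr σ₁ YA)
              open Rounds (T m) (solves m)
          in
          run-rounds (m≡ , (λ _ → refl) , (λ _ → refl))
        then λ { {σ₂} ((m≡ , _) , entries) →
        run-step tt (weaken ≤-refl
          (λ { {τ} (copied , _) →
            (λ k → rarr τ 2 (toℕ k)) ,
            entries⇒convolution x y _ (rarr σ₁ XA) (rarr σ₁ YA)
              (λ i → ≈-trans (reflexive (X≡ (k<m² i))) (x≈ i))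
              (λ i → ≈-trans (reflexive (Y≡ (k<m² i))) (y≈ i))
              (λ k → subst (ConvolutionEntry (toℕ k)) (sym (copied (k<m² k)))
                (all-positions (λ k → ConvolutionEntry k (rarr σ₂ ZA k)) entries (k<m² k))) ,
            λ _ → ≈-refl })
          (run-copy (λ ()) (cong₂ _*_ m≡ m≡))) }}

      result : Runs convolution σ₀ (convolutionCost m (T m)) Solved → _
      result (runs d t≤ q) = _ , _ , d , t≤ , q

theorem8 : (R : RealNumbers) → let open RealRAM R in
    (T : ℕ → ℕ) → MinMinusProductInTime T →
    ∃[ f ] f ∈O (λ n → (n + T ⌈√ n ⌉) * ⌈√ n ⌉) × MinMinusConvolutionInTime f
theorem8 R T product =
  (λ n → convolutionCost ⌈√ n ⌉ (T ⌈√ n ⌉)) , convolutionCost-O T , Semantics.convolution-correct R product
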